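{- Let $H\ne\{1\}$ be a reduced atomic unit-cancellative monoid and suppose that at least one of the following holds: (a) $H$ is finitely presented and there is $L\in\mathcal L(H)$ with $\rho(L)=\rho(H)<\infty$; (b) $H$ is cancellative and its monoid of relations $\sim_H$ is finitely generated; (c) $H$ is commutative and finitely generated. Then there is $M\in\mathbb N$ such that $\rho_k(H)-\rho_{k-1}(H)\le M$ for all $k\ge2$, and $\mathcal L(H)$ satisfies the Structure Theorem for Unions.
   Context: Monoid = associative semigroup with identity; reduced means the only unit is $1$; unit-cancellative means $a=au$ or $a=ua$ implies $u$ is a unit; atomic means every non-unit is a finite product of atoms. $\mathsf Z(H)$ is the free monoid on the atoms $\mathcal A(H)$ (free abelian if $H$ commutative), $\pi:\mathsf Z(H)\to H$ the canonical epimorphism, $\sim_H=\{(x,y)\mid\pi(x)=\pi(y)\}$. $H$ is finitely presented if $\mathcal A(H)$ is finite and some finite subset of $\sim_H$ generates $\sim_H$ as a congruence on $\mathsf Z(H)$. $\mathsf L(a)$ is the set of $k$ with $a$ a product of $k$ atoms ($\mathsf L(1)=\{0\}$), $\mathcal L(H)=\{\mathsf L(a)\}$. $\rho(L)=\sup(L\cap\mathbb N)/\min(L\cap\mathbb N)$ (or $1$ if $L\cap\mathbb N=\emptyset$), $\rho(H)=\sup_{L\in\mathcal L(H)}\rho(L)$; $\mathcal U_k(H)=\bigcup\{L\in\mathcal L(H)\mid k\in L\}$, $\rho_k(H)=\sup\mathcal U_k(H)$. A nonempty $L\subset\mathbb N_0$ is an almost arithmetical progression (AAP) with difference $d\in\mathbb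 N$ and bound $M\in\mathbb N_0$ if $L\subset\min L+d\mathbb Z$ and $L\cap[\min L+M,\sup L-M]$ is a nonempty arithmetical progression with difference $d$ (where $[\min L+M,\sup L-M]$ means $\mathbb N_{\ge \min L+M}$ if $L$ is infinite). $\mathcal L(H)$ satisfies the Structure Theorem for Unions if there are $d\in\mathbb N$, $M\in\mathbb N_0$ such that $\mathcal U_k(H)$ is an AAP with difference $d$ and bound $M$ for all sufficiently large $k$. -}

module Defs where

open import Level using (_⊔_)
open import Algebra.Bundles using (Monoid)
import Algebra.Construct.DirectProduct as DirectProduct
import Algebra.Definitions as AlgDefs
open import Data.Integer.Base as ℤ using (+_)
open import Data.List.Base using (List; []; _∷_; _++_; length; map; foldr)
open import Data.List.Properties using (++-assoc; ++-identityʳ)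
import Data.List.Membership.Setoid as Membership
import Data.List.Relation.Binary.Equality.Setoid as ListEq
import Data.List.Relation.Binary.Permutation.Setoid as Perm
import Data.List.Relation.Binary.Permutation.Setoid.Properties as PermProps
open import Data.List.Relation.Unary.All using (All)
open import Data.List.Relation.Unary.Enumerates.Setoid using (IsEnumeration)
open import Data.Nat.Base as ℕ using (ℕ; NonZero; _≤_; _≥_; _∸_)
open import Data.Product using (Σ; Σ-syntax; ∃; ∃-syntax; ∃₂; _×_; _,_; proj₁; proj₂)
open import Data.Rational.Base as ℚ using (ℚ; 1ℚ)
open import Data.Sum.Base using (_⊎_; inj₁; inj₂)
open import Relation.Binary.Bundles using (Setoid)
open import Relation.Binary.Core using (Rel)
import Relation.Binary.Construct.Add.Supremum.NonStrict as AddSup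
import Relation.Binary.Construct.On as On
open import Relation.Binary.PropositionalEquality.Core using (_≡_)
open import Relation.Binary.Structures using (IsEquivalence)
open import Relation.Nullary.Construct.Add.Supremum using (_⁺; [_]; ⊤⁺)
open import Relation.Nullary.Negation.Core using (¬_)
open import Relation.Unary using (Pred; _∈_; _∩_; Empty; _≐_)

ℕ∞ ℚ∞ : Set
ℕ∞ = ℕ ⁺
ℚ∞ = ℚ ⁺

open AddSup ℕ._≤_ using () renaming (_≤⁺_ to _≤ℕ∞_) public
open AddSup ℚ._≤_ using () renaming (_≤⁺_ to _≤ℚ∞_) public

IsLUB : ∀ {a r p} {A : Set a} → Rel A r → Pred A p → A → Set (a ⊔ r ⊔ p)
IsLUB _⊑_ P s = (∀ x → x ∈ P → x ⊑ s) × (∀ u → (∀ x → x ∈ P → x ⊑ u) → s ⊑ u)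

IsMin : ∀ {p} → Pred ℕ p → ℕ → Set p
IsMin L m = m ∈ L × (∀ n → n ∈ L → m ≤ n)

-- The supremum is taken in ℕ ∪ {∞}.
IsSup : ∀ {p} → Pred ℕ p → ℕ∞ → Set p
IsSup L = IsLUB _≤ℕ∞_ (λ x → ∃[ n ] (n ∈ L × x ≡ [ n ]))

Positive : Pred ℕ _
Positive n = 1 ≤ n

quotient : ℕ∞ → (m : ℕ) → .{{NonZero m}} → ℚ∞
quotient [ s ] m = [ + s ℚ./ m ]
quotient ⊤⁺    m = ⊤⁺

-- IsElasticity L r  says  ρ(L) = r.
data IsElasticity {p} (L : Pred ℕ p) : ℚ∞ → Set p where
  trivial : Empty (L ∩ Positive) → IsElasticity L [ 1ℚ ]
  ratio   : ∀ {m s} .{{_ : NonZero m}} → IsMin (L ∩ Positive) m →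
            IsSup (L ∩ Positive) s → IsElasticity L (quotient s m)

-- Non-empty arithmetical progressions {y + i d | 0 ≤ i ≤ l}, with l = ∞
-- allowed; l = 0 gives the singletons.
IsAP : ∀ {p} → ℕ → Pred ℕ p → Set p
IsAP d A = ∃₂ λ (y : ℕ) (l : ℕ∞) → A ≐ (λ n → ∃[ i ] ([ i ] ≤ℕ∞ l × n ≡ y ℕ.+ i ℕ.* d))

-- Here m = min L and s = sup L.  The condition n ≤ s − M is written
-- n + M ≤ s; it is vacuous for s = ∞, that is, for infinite L.
IsAAP : ∀ {p} → ℕ → ℕ → Pred ℕ p → Set p
IsAAP d M L = ∃₂ λ (m : ℕ) (s : ℕ∞) →
  IsMin L m ×
  IsSup L s ×
  (∀ n → n ∈ L → ∃[ z ] (+ n ≡ + m ℤ.+ + d ℤ.* z)) ×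
  IsAP d (L ∩ (λ n → m ℕ.+ M ≤ n × [ n ℕ.+ M ] ≤ℕ∞ s))

FinitelyGenerated : ∀ {c ℓ} → Monoid c ℓ → Set (c ⊔ ℓ)
FinitelyGenerated M =
  ∃[ gs ] (∀ a → ∃[ xs ] (All (λ x → Membership._∈_ setoid x gs) xs × foldr _∙_ ε xs ≈ a))
  where open Monoid M

module Factorization {c ℓ} (H : Monoid c ℓ) where

  open Monoid H
  open AlgDefs _≈_ using (Invertible; Commutative; Cancellative)

  IsUnit : Pred Carrier (c ⊔ ℓ)
  IsUnit = Invertible ε _∙_

  IsTrivial : Set (c ⊔ ℓ)
  IsTrivial = ∀ a → a ≈ ε

  IsReduced : Set (c ⊔ ℓ)
  IsReduced = ∀ u → IsUnit u → u ≈ ε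

  IsUnitCancellative : Set (c ⊔ ℓ)
  IsUnitCancellative = ∀ a u → (a ≈ a ∙ u) ⊎ (a ≈ u ∙ a) → IsUnit u

  IsCancellative : Set (c ⊔ ℓ)
  IsCancellative = Cancellative _∙_

  IsCommutative : Set (c ⊔ ℓ)
  IsCommutative = Commutative _∙_

  IsAtom : Pred Carrier (c ⊔ ℓ)
  IsAtom u = ¬ IsUnit u × (∀ a b → u ≈ a ∙ b → IsUnit a ⊎ IsUnit b)

  atoms : Setoid (c ⊔ ℓ) ℓ
  atoms = record
    { Carrier       = Σ Carrier IsAtom
    ; _≈_           = λ x y → proj₁ x ≈ proj₁ y
    ; isEquivalence = On.isEquivalence proj₁ isEquivalence
    }

  Atom : Set (c ⊔ ℓ)
  Atom = Setoid.Carrier atoms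

  open ListEq atoms using (_≋_; ≋-refl; ≋-sym; ≋-trans; ≋-reflexive; ++⁺)
  open Perm atoms using (_↭_; ↭-sym; ↭-trans; ↭-reflexive-≋)

  Factor : Set (c ⊔ ℓ)
  Factor = List Atom

  -- Equality in Z(H): equality of words in general, and equality up to the
  -- order of the letters (free abelian monoid) if H is commutative.
  infix 4 _≈ᶻ_
  _≈ᶻ_ : Rel Factor (c ⊔ ℓ)
  x ≈ᶻ y = x ≋ y ⊎ (IsCommutative × x ↭ y)

  π : Factor → Carrier
  π z = foldr _∙_ ε (map proj₁ z)

  ≈ᶻ-isEquivalence : IsEquivalence _≈ᶻ_
  ≈ᶻ-isEquivalence = record
    { refl  = inj₁ ≋-refl
    ; sym   = λ { (inj₁ p) → inj₁ (≋-sym p) ; (inj₂ (comm , p)) → inj₂ (comm , ↭-sym p) }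
    ; trans = λ
      { (inj₁ p)          (inj₁ q)          → inj₁ (≋-trans p q)
      ; (inj₁ p)          (inj₂ (comm , q)) → inj₂ (comm , ↭-trans (↭-reflexive-≋ p) q)
      ; (inj₂ (comm , p)) (inj₁ q)          → inj₂ (comm , ↭-trans p (↭-reflexive-≋ q))
      ; (inj₂ (comm , p)) (inj₂ (_    , q)) → inj₂ (comm , ↭-trans p q)
      }
    }

  ≈ᶻ-++-cong : ∀ {x y u v} → x ≈ᶻ y → u ≈ᶻ v → x ++ u ≈ᶻ y ++ v
  ≈ᶻ-++-cong (inj₁ p) (inj₁ q) = inj₁ (++⁺ p q)
  ≈ᶻ-++-cong (inj₁ p) (inj₂ (comm , q)) =
    inj₂ (comm , PermProps.++⁺ atoms (↭-reflexive-≋ p) q)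
  ≈ᶻ-++-cong (inj₂ (comm , p)) (inj₁ q) =
    inj₂ (comm , PermProps.++⁺ atoms p (↭-reflexive-≋ q))
  ≈ᶻ-++-cong (inj₂ (comm , p)) (inj₂ (_ , q)) =
    inj₂ (comm , PermProps.++⁺ atoms p q)

  -- Z(H)
  factorizationMonoid : Monoid (c ⊔ ℓ) (c ⊔ ℓ)
  factorizationMonoid = record
    { Carrier  = Factor
    ; _≈_      = _≈ᶻ_
    ; _∙_      = _++_
    ; ε        = []
    ; isMonoid = record
      { isSemigroup = record
        { isMagma = record
          { isEquivalence = ≈ᶻ-isEquivalence
          ; ∙-cong        = ≈ᶻ-++-cong
          }
        ; assoc = λ x y z → inj₁ (≋-reflexive (++-assoc x y z))
        }
      ; identity = (λ x → inj₁ ≋-refl) , (λ x → inj₁ (≋-reflexive (++-identityʳ x)))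
      }
    }

  π-++ : ∀ x y → π (x ++ y) ≈ π x ∙ π y
  π-++ []      y = sym (identityˡ (π y))
  π-++ (a ∷ x) y = trans (∙-congˡ (π-++ x y)) (sym (assoc (proj₁ a) (π x) (π y)))

  infix 4 _∼_
  _∼_ : Rel Factor ℓ
  x ∼ y = π x ≈ π y

  Relation : Set (c ⊔ ℓ)
  Relation = Σ[ (x , y) ∈ Factor × Factor ] x ∼ y

  -- ∼_H as a submonoid of Z(H) × Z(H)
  relationMonoid : Monoid (c ⊔ ℓ) (c ⊔ ℓ)
  relationMonoid = record
    { Carrier  = Relation
    ; _≈_      = λ r s → proj₁ r ZZ.≈ proj₁ s
    ; _∙_      = λ { (r@(x , y) , p) (s@(u , v) , q) →
                     r ZZ.∙ s , trans (π-++ x u) (trans (∙-cong p q) (sym (π-++ y v))) }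
    ; ε        = ZZ.ε , refl
    ; isMonoid = record
      { isSemigroup = record
        { isMagma = record
          { isEquivalence = On.isEquivalence proj₁ ZZ.isEquivalence
          ; ∙-cong        = λ {r} {s} {t} {u} → ZZ.∙-cong {proj₁ r} {proj₁ s} {proj₁ t} {proj₁ u}
          }
        ; assoc = λ r s t → ZZ.assoc (proj₁ r) (proj₁ s) (proj₁ t)
        }
      ; identity = (λ r → ZZ.identityˡ (proj₁ r)) , (λ r → ZZ.identityʳ (proj₁ r))
      }
    }
    where
    module ZZ = Monoid (DirectProduct.monoid factorizationMonoid factorizationMonoid)

  -- The smallest congruence on Z(H) containing the given pairs.
  data Congruence (R : List Relation) : Rel Factor (c ⊔ ℓ) where
    gen     : ∀ {r} → Membership._∈_ (Monoid.setoid relationMonoid) r R →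
              Congruence R (proj₁ (proj₁ r)) (proj₂ (proj₁ r))
    ≈ᶻ⇒     : ∀ {x y} → x ≈ᶻ y → Congruence R x y
    symm    : ∀ {x y} → Congruence R x y → Congruence R y x
    transit : ∀ {x y z} → Congruence R x y → Congruence R y z → Congruence R x z
    compat  : ∀ {x y u v} → Congruence R x y → Congruence R u v → Congruence R (x ++ u) (y ++ v)

  -- As R consists of elements of ∼_H, the congruence it generates is always
  -- contained in ∼_H.
  IsFinitelyPresented : Set (c ⊔ ℓ)
  IsFinitelyPresented =
    ∃ (IsEnumeration atoms) × (∃[ R ] (∀ x y → x ∼ y → Congruence R x y))

  IsAtomic : Set (c ⊔ ℓ)
  IsAtomic = ∀ a → ¬ IsUnit a → ∃[ z ] (π z ≈ a)

  -- The sets of lengths.  L(1) = {0} needs no separate clause: the empty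
  -- product has length 0, and in a unit-cancellative monoid 1 is not a
  -- non-empty product of atoms.
  L : Carrier → Pred ℕ (c ⊔ ℓ)
  L a k = ∃[ z ] (length z ≡ k × π z ≈ a)

  -- 𝓛(H) is represented by the family (L a) indexed by a ∈ H.
  U : ℕ → Pred ℕ (c ⊔ ℓ)
  U k n = ∃[ a ] (k ∈ L a × n ∈ L a)

  -- ρ(H) = r.  A least upper bound in ℚ ∪ {∞} is also the supremum in
  -- ℝ ∪ {∞}; this does not cover irrational values of ρ(H).
  HasElasticity : ℚ∞ → Set (c ⊔ ℓ)
  HasElasticity = IsLUB _≤ℚ∞_ (λ r → ∃[ a ] IsElasticity (L a) r)

  -- ρ(L) = ρ(H) < ∞ for some L ∈ 𝓛(H); as ρ(L) is then rational, so is ρ(H).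
  HasAcceptedElasticity : Set (c ⊔ ℓ)
  HasAcceptedElasticity = ∃₂ λ a (q : ℚ) → IsElasticity (L a) [ q ] × HasElasticity [ q ]

  -- ρ_k(H) = r
  IsRho : ℕ → ℕ∞ → Set (c ⊔ ℓ)
  IsRho k = IsSup (U k)

  StructureTheoremForUnions : Set (c ⊔ ℓ)
  StructureTheoremForUnions =
    ∃₂ λ d M → 1 ≤ d × (∃[ k₀ ] (∀ k → k ≥ k₀ → IsAAP d M (U k)))

  -- The difference presupposes that ρ_k(H) and ρ_{k-1}(H) are finite.
  BoundedRhoDifferences : Set (c ⊔ ℓ)
  BoundedRhoDifferences =
    ∃[ M ] (1 ≤ M × (∀ k → k ≥ 2 → ∃₂ λ r r′ →
      IsRho k [ r ] × IsRho (k ∸ 1) [ r′ ] × + r ℤ.- + r′ ℤ.≤ + M))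

{-# OPTIONS --safe #-}
module Submission where

-- Call (k , l) a length pair if k and l are lengths of a common element.  Length pairs form a
-- symmetric submonoid of ℕ × ℕ containing the diagonal.  In each of the three cases there is a
-- ratio s / m and a constant c₀ such that l / k ≤ s / m for every length pair, while all
-- (j m + c₀ , j s + c₀) are length pairs.  This alone gives ρ_k = (s / m) k + O(1), hence the
-- bounded differences.  The differences of length pairs are the multiples of the least positive
-- one, d; filling the steps of length s − m with boundedly many steps of length d shows that U k
-- contains every number between its minimum and maximum that is congruent to k modulo d and not
-- too close to either of them.
--
-- In case (a), s / m is the accepted elasticity.  In case (b), it is the largest ratio among the
-- generators of the monoid of relations.  In case (c) the elasticity need not be accepted; here
-- one passes to the cancellative congruence  a z ≈ b z for some z,  which by Dickson's lemma has
-- a finite basis, and c₀ is the length of the factor z belonging to a basis element of largest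
-- ratio.

open import Defs
open import Level using (Level; _⊔_)
open import Algebra.Bundles using (Monoid; CommutativeMonoid)
import Algebra.Construct.DirectProduct as DirectProduct
import Algebra.Properties.CommutativeSemigroup as CommutativeSemigroupProperties
import Algebra.Properties.Monoid.Mult as Mult
open import Axiom.ExcludedMiddle using (ExcludedMiddle)
import Data.Integer.Base as ℤ
import Data.Integer.Properties as ℤ
open import Data.List.Base using (List; []; _∷_; _++_; map; length; foldr; replicate)
import Data.List.Membership.Setoid as Membership
open import Data.List.Properties using (length-++; length-replicate)
import Data.List.Relation.Binary.Permutation.Setoid.Properties as Permutation
open import Data.List.Relation.Binary.Pointwise using (Pointwise-length)
open import Data.List.Relation.Unary.All as All using (All; []; _∷_)
import Data.List.Relation.Unary.All.Properties as All
open import Data.List.Relation.Unary.Any as Any using (Any; here; there)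
import Data.List.Relation.Unary.Any.Properties as Any
open import Data.Nat.Base hiding (_⊔_)
open import Data.Nat.Base using () renaming (_⊔_ to _ℕ⊔_)
open import Data.Nat.Divisibility using (_∣_; divides; m%n≡0⇒n∣m)
open import Data.Nat.DivMod using (m≡m%n+[m/n]*n; m%n<n; m/n*n≤m)
open import Data.Nat.Properties
open import Data.Nat.Tactic.RingSolver using (solve-∀)
open import Data.Product using (∃; ∃-syntax; ∃₂; _×_; _,_; proj₁; proj₂; uncurry)
import Data.Rational.Base as ℚ
import Data.Rational.Properties as ℚ
import Data.Rational.Unnormalised.Base as ℚᵘ
import Data.Rational.Unnormalised.Properties as ℚᵘ
open import Data.Sum.Base as Sum using (_⊎_; inj₁; inj₂)
import Relation.Binary.Construct.Add.Supremum.NonStrict as AddSup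
open import Relation.Binary.Definitions using (_Respects_)
open import Relation.Binary.PropositionalEquality as ≡ using (_≡_; _≢_; cong; cong₂; subst; subst₂)
import Relation.Binary.Reasoning.Setoid as SetoidReasoning
open import Relation.Nullary.Construct.Add.Supremum using ([_]; ⊤⁺; []-injective)
open import Relation.Nullary.Decidable.Core using (yes; no)
open import Relation.Nullary.Negation.Core using (¬_; contradiction)
open import Relation.Unary using (Pred; _∈_; _∩_)

open AddSup _≤_ using ([≤]-injective)

-- Minima, maxima and suprema of sets of natural numbers.

private
  variable
    p : Level

module _ {P : Pred ℕ p} where

  min-exists : ExcludedMiddle p → ∀ {n} → P n → ∃[ m ] IsMin P m
  min-exists em {n} pn with search (suc n)
    where
    search : ∀ b → (∃[ m ] IsMin P m) ⊎ (∀ i → i < b → ¬ P i)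
    search zero = inj₂ λ _ ()
    search (suc b) with search b
    ... | inj₁ found = inj₁ found
    ... | inj₂ none with em {P b}
    ...   | yes pb = inj₁ (b , pb , λ i pi → ≮⇒≥ λ i<b → none i i<b pi)
    ...   | no ¬pb = inj₂ none′
      where
      none′ : ∀ i → i < suc b → ¬ P i
      none′ i i<1+b pi with m≤n⇒m<n∨m≡n (≤-pred i<1+b)
      ... | inj₁ i<b    = none i i<b pi
      ... | inj₂ ≡.refl = ¬pb pi
  ... | inj₁ found = found
  ... | inj₂ none  = contradiction pn (none n ≤-refl)

  IsMax : ℕ → Set p
  IsMax s = P s × (∀ n → P n → n ≤ s)

  max-exists : ExcludedMiddle p → ∀ b → (∀ n → P n → n ≤ b) → ∀ {n} → P n → ∃ IsMax
  max-exists em b ub pn with em {P b}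
  ... | yes pb = b , pb , ub
  max-exists em zero ub {n} pn | no ¬pb = contradiction (subst P (n≤0⇒n≡0 (ub n pn)) pn) ¬pb
  max-exists em (suc b) ub pn | no ¬pb =
    max-exists em b (λ i pi → ≤-pred (≤∧≢⇒< (ub i pi) λ { ≡.refl → ¬pb pi })) pn

  IsMax⇒IsSup : ∀ {s} → IsMax s → IsSup P [ s ]
  IsMax⇒IsSup {s} (ps , ub) =
    (λ { _ (n , pn , ≡.refl) → AddSup.[ ub n pn ] }) , λ u bounds → bounds [ s ] (s , ps , ≡.refl)

  IsSup⇒IsMax : ExcludedMiddle p → ∀ {n s} → P n → IsSup P [ s ] → IsMax s
  IsSup⇒IsMax em {n} {s} pn (ub , lub)
    with max-exists em s (λ i pi → [≤]-injective (ub _ (i , pi , ≡.refl))) pn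
  ... | t , pt , ub′ = subst IsMax (≤-antisym t≤s s≤t) (pt , ub′)
    where
    t≤s = [≤]-injective (ub _ (t , pt , ≡.refl))
    s≤t = [≤]-injective (lub [ t ] λ { _ (i , pi , ≡.refl) → AddSup.[ ub′ i pi ] })

  sup-exists : ExcludedMiddle p → ∀ {n} → P n → ∃ (IsSup P)
  sup-exists em pn with em {∃[ b ] (∀ n → P n → n ≤ b)}
  ... | yes (b , ub) = let s , max = max-exists em b ub pn in [ s ] , IsMax⇒IsSup max
  ... | no unbounded = ⊤⁺ , (λ x _ → x AddSup.≤⊤⁺) , λ
    { [ b ] ub → contradiction (b , λ n pn → [≤]-injective (ub _ (n , pn , ≡.refl))) unbounded
    ; ⊤⁺ _ → ⊤⁺ AddSup.≤⊤⁺
    }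

-- Length relations and the growth of their maxima.

record IsLengthRelation (U : ℕ → Pred ℕ p) : Set p where
  field
    U-refl : ∀ k → U k k
    U-sym  : ∀ {k l} → U k l → U l k
    U-add  : ∀ {k l k′ l′} → U k l → U k′ l′ → U (k + k′) (l + l′)

  U-mult : ∀ {k l} j → U k l → U (j * k) (j * l)
  U-mult zero    u = U-refl 0
  U-mult (suc j) u = U-add u (U-mult j u)

-- The limiting ratio `s / m` is written `(m + e) / m`, so that the excess `e` appears without
-- subtraction.
module Unions (em : ExcludedMiddle p) (U : ℕ → Pred ℕ p) (isLengthRelation : IsLengthRelation U)
  (m e c₀ : ℕ) .{{m≢0 : NonZero m}}
  (attained : ∀ j → U (j * m + c₀) (j * (m + e) + c₀))
  (bound : ∀ {k l} → U k l → l * m ≤ (m + e) * k)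
  where

  open IsLengthRelation isLengthRelation

  ρ-exists : ∀ k → ∃ (IsMax {P = U k})
  ρ-exists k = max-exists em ((m + e) * k) (λ l u → ≤-trans (m≤m*n l m) (bound u)) (U-refl k)

  bounded-rho-differences : ∃[ M ] (1 ≤ M × (∀ k → k ≥ 2 → ∃₂ λ r r′ →
    IsSup (U k) [ r ] × IsSup (U (k ∸ 1)) [ r′ ] × ℤ.+ r ℤ.- ℤ.+ r′ ℤ.≤ ℤ.+ M))
  bounded-rho-differences = M , s≤s z≤n , differences
    where
    -- By `bound` and `ρ-lower`, `r * m` exceeds `r′ * m` by at most `m + e * (1 + c₀ + m)`;
    -- dividing by `m` leaves at most this `M`.
    M = 1 + e * (1 + c₀ + m)

    -- For `c₀ ≤ k`, write `k = j * m + c₀ + i` with `i < m` and add the diagonal pair `(i , i)` to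
    -- `attained j`; the loss is `e * (c₀ + i)`. For smaller `k`, `k ∈ U k` suffices.
    ρ-lower : ∀ k {r} → IsMax {P = U k} r → k * (m + e) ≤ r * m + e * (c₀ + m)
    ρ-lower k {r} (_ , ub) with ≤-total c₀ k
    ... | inj₂ k≤c₀ = begin
      k * (m + e)               ≡⟨ *-distribˡ-+ k m e ⟩
      k * m + k * e             ≤⟨ +-mono-≤ (*-monoˡ-≤ m (ub k (U-refl k)))
                                            (*-monoˡ-≤ e (≤-trans k≤c₀ (m≤m+n c₀ m))) ⟩
      r * m + (c₀ + m) * e      ≡⟨ cong (r * m +_) (*-comm (c₀ + m) e) ⟩
      r * m + e * (c₀ + m)      ∎
      where open ≤-Reasoning
    ... | inj₁ c₀≤k = begin
      k * (m + e)                                 ≡⟨ cong (_* (m + e)) k≡ ⟩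
      (j * m + c₀ + i) * (m + e)                  ≡⟨ rearrange j m c₀ i e ⟩
      (j * (m + e) + c₀ + i) * m + e * (c₀ + i)   ≤⟨ +-mono-≤ (*-monoˡ-≤ m (ub _ u)) (*-monoʳ-≤ e (+-monoʳ-≤ c₀ i≤m)) ⟩
      r * m + e * (c₀ + m) ∎
      where
      open ≤-Reasoning
      j = (k ∸ c₀) / m
      i = (k ∸ c₀) % m
      i≤m = <⇒≤ (m%n<n (k ∸ c₀) m)
      k≡ : k ≡ j * m + c₀ + i
      k≡ = ≡.trans (≡.sym (m+[n∸m]≡n c₀≤k))
        (≡.trans (cong (c₀ +_) (m≡m%n+[m/n]*n (k ∸ c₀) m)) (+-rotate c₀ i (j * m)))
        where
        +-rotate : ∀ x y z → x + (y + z) ≡ z + x + y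
        +-rotate = solve-∀
      rearrange : ∀ j m c i e → (j * m + c + i) * (m + e) ≡ (j * (m + e) + c + i) * m + e * (c + i)
      rearrange = solve-∀
      u : U k (j * (m + e) + c₀ + i)
      u = subst (λ x → U x (j * (m + e) + c₀ + i)) (≡.sym k≡) (U-add (attained j) (U-refl i))

    ρ-step : ∀ k {r r′} → IsMax {P = U (suc k)} r → IsMax {P = U k} r′ → r ≤ M + r′
    ρ-step k {r} {r′} (ur , _) max′ = *-cancelʳ-≤ r (M + r′) m (begin
      r * m                              ≤⟨ bound ur ⟩
      (m + e) * suc k                    ≡⟨ rearrange₁ m e k ⟩
      m + e + k * (m + e)                ≤⟨ +-monoʳ-≤ (m + e) (ρ-lower k max′) ⟩
      m + e + (r′ * m + e * (c₀ + m))    ≡⟨ rearrange₂ m e r′ c₀ ⟩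
      (1 * m + e * (1 + c₀ + m)) + r′ * m ≤⟨ +-monoˡ-≤ (r′ * m) (+-monoʳ-≤ (1 * m) (m≤m*n (e * (1 + c₀ + m)) m)) ⟩
      (1 * m + e * (1 + c₀ + m) * m) + r′ * m ≡⟨ cong (_+ r′ * m) (*-distribʳ-+ m 1 (e * (1 + c₀ + m))) ⟨
      M * m + r′ * m                     ≡⟨ *-distribʳ-+ m M r′ ⟨
      (M + r′) * m                       ∎)
      where
      open ≤-Reasoning
      rearrange₁ : ∀ m e k → (m + e) * suc k ≡ m + e + k * (m + e)
      rearrange₁ = solve-∀
      rearrange₂ : ∀ m e r c → m + e + (r * m + e * (c + m)) ≡ 1 * m + e * (1 + c + m) + r * m
      rearrange₂ = solve-∀

    differences : ∀ k → k ≥ 2 → ∃₂ λ r r′ →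
      IsSup (U k) [ r ] × IsSup (U (k ∸ 1)) [ r′ ] × ℤ.+ r ℤ.- ℤ.+ r′ ℤ.≤ ℤ.+ M
    differences (suc k) _ with ρ-exists (suc k) | ρ-exists k
    ... | r , max | r′ , max′ = r , r′ , IsMax⇒IsSup max , IsMax⇒IsSup max′ , (begin
      ℤ.+ r ℤ.- ℤ.+ r′              ≤⟨ ℤ.+-monoˡ-≤ (ℤ.- (ℤ.+ r′)) (ℤ.+≤+ (ρ-step k max max′)) ⟩
      ℤ.+ (M + r′) ℤ.- ℤ.+ r′       ≡⟨ ℤ.+-assoc (ℤ.+ M) (ℤ.+ r′) (ℤ.- (ℤ.+ r′)) ⟩
      ℤ.+ M ℤ.+ (ℤ.+ r′ ℤ.- ℤ.+ r′) ≡⟨ cong (ℤ._+_ (ℤ.+ M)) (ℤ.+-inverseʳ (ℤ.+ r′)) ⟩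
      ℤ.+ M ℤ.+ ℤ.+ 0               ≡⟨ ℤ.+-identityʳ (ℤ.+ M) ⟩
      ℤ.+ M                         ∎)
      where open ℤ.≤-Reasoning

  -- Differences of length pairs and the shape of unions.

  Difference : Pred ℕ p
  Difference t = ∃[ k ] U k (k + t)

  -- The first pair is added to a reversal of the second. This closure lets division with remainder
  -- act on differences.
  Difference-∸ : ∀ {r t} → Difference (r + t) → Difference t → Difference r
  Difference-∸ {r} {t} (k , u) (k′ , u′) =
    k + (k′ + t) , subst (U _) (rearrange k r t k′) (U-add u (U-sym u′))
    where
    rearrange : ∀ k r t k′ → k + (r + t) + k′ ≡ k + (k′ + t) + r
    rearrange = solve-∀

  Difference-* : ∀ q {t} → Difference t → Difference (q * t)
  Difference-* q {t} (k , u) = q * k , subst (U _) (*-distribˡ-+ q k t) (U-mult q u)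

  -- The pairs `(k , l′)` and `(l , k)` add up to `(k + l , l′ + k)`, which has the required
  -- difference.
  U⇒Difference : ∀ {k l l′} → U k l → U k l′ → l ≤ l′ → Difference (l′ ∸ l)
  U⇒Difference {k} {l} {l′} u u′ l≤l′ =
    k + l , subst (U (k + l)) eq (U-add u′ (U-sym u))
    where
    eq : l′ + k ≡ k + l + (l′ ∸ l)
    eq = ≡.trans (+-comm l′ k) (≡.trans (cong (k +_) (≡.sym (m+[n∸m]≡n l≤l′))) (≡.sym (+-assoc k l _)))

  e-difference : Difference e
  e-difference = 1 * m + c₀ , subst (U (1 * m + c₀)) (rearrange m e c₀) (attained 1)
    where
    rearrange : ∀ m e c → 1 * (m + e) + c ≡ 1 * m + c + e
    rearrange = solve-∀

  -- The pair `(k* , k* + d)` realises a difference `d` that divides all others. `M` is a multiple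
  -- of `d`, so shifts by `M` keep the residue class, and it is large enough to pay for `c₀` and for
  -- up to `f` steps of length `d`.
  module Progression (d k* : ℕ) .{{d≢0 : NonZero d}} (u* : U k* (k* + d))
    (d∣differences : ∀ {t} → Difference t → d ∣ t)
    (f : ℕ) (e≡fd : e ≡ f * d) .{{f≢0 : NonZero f}}
    (g M : ℕ) (M≡gd : M ≡ g * d) (M-large : e * (c₀ + f * k*) ≤ M) where

    instance
      e≢0 : NonZero e
      e≢0 = subst NonZero (≡.sym e≡fd) (m*n≢0 f d)

    -- Write t = q f + r with r < f and combine q steps of length e with r steps of length d.
    fill : ∀ n t → (t * d + M) * m ≤ e * n → U n (n + t * d)
    fill n t fits = subst₂ U (m+[n∸m]≡n small) eq (U-add (U-add (attained q) (U-mult r u*)) (U-refl i))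
      where
      q = t / f
      r = t % f
      -- The chosen pairs start at `q * m + c₀ + r * k*`, which has to fit below `n`; the diagonal
      -- supplies the remaining `i`. The factor `e` allows the comparison of `q * e` with `t * d`.
      small′ : e * (q * m + c₀ + f * k*) ≤ e * n
      small′ = begin
        e * (q * m + c₀ + f * k*)                ≡⟨ rearrange₁ e q m c₀ (f * k*) ⟩
        q * e * m + e * (c₀ + f * k*)            ≤⟨ +-monoʳ-≤ (q * e * m) (≤-trans M-large (m≤m*n M m)) ⟩
        q * e * m + M * m                        ≤⟨ +-monoˡ-≤ (M * m) (*-monoˡ-≤ m qe≤td) ⟩
        t * d * m + M * m                        ≡⟨ *-distribʳ-+ m (t * d) M ⟨
        (t * d + M) * m                          ≤⟨ fits ⟩
        e * n                                    ∎
        where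
        open ≤-Reasoning
        rearrange₁ : ∀ e q m c x → e * (q * m + c + x) ≡ q * e * m + e * (c + x)
        rearrange₁ = solve-∀
        qe≤td : q * e ≤ t * d
        qe≤td = begin
          q * e          ≡⟨ cong (q *_) e≡fd ⟩
          q * (f * d)    ≡⟨ *-assoc q f d ⟨
          q * f * d      ≤⟨ *-monoˡ-≤ d (m/n*n≤m t f) ⟩
          t * d          ∎
      small : q * m + c₀ + r * k* ≤ n
      small = ≤-trans (+-monoʳ-≤ (q * m + c₀) (*-monoˡ-≤ k* (<⇒≤ (m%n<n t f)))) (*-cancelˡ-≤ e small′)
      i = n ∸ (q * m + c₀ + r * k*)
      eq : q * (m + e) + c₀ + r * (k* + d) + i ≡ n + t * d
      eq = begin
        q * (m + e) + c₀ + r * (k* + d) + i          ≡⟨ cong (λ x → q * (m + x) + c₀ + r * (k* + d) + i) e≡fd ⟩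
        q * (m + f * d) + c₀ + r * (k* + d) + i      ≡⟨ rearrange₂ q m f d c₀ r k* i ⟩
        q * m + c₀ + r * k* + i + (r + q * f) * d    ≡⟨ cong₂ (λ x y → x + y * d) (m+[n∸m]≡n small) (≡.sym t≡) ⟩
        n + t * d                                    ∎
        where
        open ≡.≡-Reasoning
        t≡ = m≡m%n+[m/n]*n t f
        rearrange₂ : ∀ q m f d c r k i → q * (m + f * d) + c + r * (k + d) + i ≡ q * m + c + r * k + i + (r + q * f) * d
        rearrange₂ = solve-∀

    fillM : ∀ n → 2 * M * m ≤ n → U n (n + M)
    fillM n large = subst (λ x → U n (n + x)) (≡.sym M≡gd) (fill n g (begin
      (g * d + M) * m                 ≡⟨ cong (λ x → (x + M) * m) M≡gd ⟨
      (M + M) * m                     ≡⟨ cong (λ x → (M + x) * m) (+-identityʳ M) ⟨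
      2 * M * m                       ≤⟨ large ⟩
      n                               ≤⟨ m≤n*m n e ⟩
      e * n                           ∎))
      where open ≤-Reasoning

    -- Cancelling `m * k` in `(n + M) * m ≤ ρ * m ≤ (m + e) * k` leaves the hypothesis of `fill`.
    fill-upper : ∀ {k ρ n} → U k ρ → k ≤ n → d ∣ n ∸ k → n + M ≤ ρ → U k n
    fill-upper {k} {ρ} {n} uρ k≤n (divides t n∸k≡) n+M≤ρ = subst (U k) k+td≡n (fill k t fits)
      where
      k+td≡n : k + t * d ≡ n
      k+td≡n = ≡.trans (cong (k +_) (≡.sym n∸k≡)) (m+[n∸m]≡n k≤n)
      fits : (t * d + M) * m ≤ e * k
      fits = +-cancelˡ-≤ (m * k) _ _ (begin
        m * k + (t * d + M) * m ≡⟨ rearrange m k (t * d) M ⟩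
        (k + t * d + M) * m     ≡⟨ cong (λ x → (x + M) * m) k+td≡n ⟩
        (n + M) * m             ≤⟨ *-monoˡ-≤ m n+M≤ρ ⟩
        ρ * m                   ≤⟨ bound uρ ⟩
        (m + e) * k             ≡⟨ *-distribʳ-+ k m e ⟩
        m * k + e * k           ∎)
        where
        open ≤-Reasoning
        rearrange : ∀ m k x M → m * k + (x + M) * m ≡ (k + x + M) * m
        rearrange = solve-∀

    -- By symmetry one climbs from `n` to `k`. For the reversed pair `(μ , k)`, `bound` gives
    -- `k * m ≤ (m + e) * μ`, and the distance of at least `M` from `μ` to `n` pays for the rest.
    fill-lower : ∀ {k μ n} → U k μ → n ≤ k → d ∣ k ∸ n → μ + M ≤ n → U k n
    fill-lower {k} {μ} {n} uμ n≤k (divides t k∸n≡) μ+M≤n = U-sym (subst (U n) n+td≡k (fill n t fits))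
      where
      n+td≡k : n + t * d ≡ k
      n+td≡k = ≡.trans (cong (n +_) (≡.sym k∸n≡)) (m+[n∸m]≡n n≤k)
      fits : (t * d + M) * m ≤ e * n
      fits = +-cancelˡ-≤ (m * n) _ _ (begin
        m * n + (t * d + M) * m      ≡⟨ rearrange m n (t * d) M ⟩
        (n + t * d) * m + M * m      ≡⟨ cong (λ x → x * m + M * m) n+td≡k ⟩
        k * m + M * m                ≤⟨ +-mono-≤ (bound (U-sym uμ)) (*-monoʳ-≤ M (m≤m+n m e)) ⟩
        (m + e) * μ + M * (m + e)    ≡⟨ rearrange′ m e μ M ⟩
        (m + e) * (μ + M)            ≤⟨ *-monoʳ-≤ (m + e) μ+M≤n ⟩
        (m + e) * n                  ≡⟨ *-distribʳ-+ n m e ⟩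
        m * n + e * n                ∎)
        where
        open ≤-Reasoning
        rearrange : ∀ m n x M → m * n + (x + M) * m ≡ (n + x) * m + M * m
        rearrange = solve-∀
        rearrange′ : ∀ m e μ M → (m + e) * μ + M * (m + e) ≡ (m + e) * (μ + M)
        rearrange′ = solve-∀

    -- The lower bound on `k` makes `fillM` applicable both at `k` and at `k ∸ M`.
    module Interval (k : ℕ) (k≥ : k ≥ 2 * M * m + M) (μ ρ : ℕ)
      (uμ : U k μ) (lb : ∀ n → U k n → μ ≤ n) (uρ : U k ρ) (ub : ∀ n → U k n → n ≤ ρ) where
      open ≤-Reasoning

      multiple : ∀ {n n′} → U k n → U k n′ → n ≤ n′ → ∃[ t ] n′ ≡ n + t * d
      multiple {n} u u′ n≤n′ =
        let divides t eq = d∣differences (U⇒Difference u u′ n≤n′)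
        in t , ≡.trans (≡.sym (m+[n∸m]≡n n≤n′)) (cong (n +_) eq)

      congruent : ∀ n → n ∈ U k → ∃[ z ] (ℤ.+ n ≡ ℤ.+ μ ℤ.+ ℤ.+ d ℤ.* z)
      congruent n u =
        let t , n≡ = multiple uμ u (lb n u)
        in ℤ.+ t , ≡.trans (cong ℤ.+_ n≡) (cong (ℤ._+_ (ℤ.+ μ)) (≡.trans (cong ℤ.+_ (*-comm t d)) (ℤ.pos-* d t)))

      remove-M : ∀ {x y} t → y ≡ x + t * d → x + M ≤ y → y ≡ x + M + (t ∸ g) * d
      remove-M {x} {y} t y≡ x+M≤y = begin-equality
        y                        ≡⟨ y≡ ⟩
        x + t * d                ≡⟨ cong (x +_) (m+[n∸m]≡n (+-cancelˡ-≤ x M (t * d) (≤-trans x+M≤y (≤-reflexive y≡)))) ⟨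
        x + (M + (t * d ∸ M))    ≡⟨ +-assoc x M _ ⟨
        x + M + (t * d ∸ M)      ≡⟨ cong (λ z → x + M + (t * d ∸ z)) M≡gd ⟩
        x + M + (t * d ∸ g * d)  ≡⟨ cong (x + M +_) (*-distribʳ-∸ d t g) ⟨
        x + M + (t ∸ g) * d      ∎

      -- The elements k ± M of U k show that the interval is not empty.
      k+M≤ρ : k + M ≤ ρ
      k+M≤ρ = ub _ (fillM k (≤-trans (m≤m+n _ M) k≥))

      μ+M≤k : μ + M ≤ k
      μ+M≤k = begin
        μ + M       ≤⟨ +-monoˡ-≤ M (lb (k ∸ M) (U-sym (subst (U (k ∸ M)) k∸M+M (fillM (k ∸ M) (m+n≤o⇒m≤o∸n _ k≥))))) ⟩
        k ∸ M + M   ≡⟨ k∸M+M ⟩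
        k           ∎
        where
        k∸M+M : k ∸ M + M ≡ k
        k∸M+M = m∸n+n≡m (≤-trans (m≤n+m M _) k≥)

      abstract
        -- This is the first term of the progression. As `M` is a multiple of `d`, it lies in the
        -- residue class of `k`, and `fill-lower` applies with equality.
        uμM : U k (μ + M)
        uμM =
          let t , k≡ = multiple uμ (U-refl k) (lb k (U-refl k))
          in fill-lower uμ μ+M≤k
               (divides (t ∸ g) (≡.trans (cong (_∸ (μ + M)) (remove-M t k≡ μ+M≤k)) (m+n∸m≡n (μ + M) _))) ≤-refl

        -- The progression has to end exactly `M` below `ρ`; `μ + M ≤ k` and `k + M ≤ ρ` leave room
        -- for both margins.
        top : ∃[ l ] ρ ≡ μ + M + M + l * d
        top =
          let t , ρ≡ = multiple uμM uρ (≤-trans μ+M≤k (ub k (U-refl k)))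
          in t ∸ g , remove-M t ρ≡ (≤-trans (+-monoˡ-≤ M μ+M≤k) k+M≤ρ)

      l = proj₁ top

      ρ≡ : ρ ≡ μ + M + l * d + M
      ρ≡ = ≡.trans (proj₂ top) (rearrange (μ + M) M (l * d))
        where
        rearrange : ∀ x y z → x + y + z ≡ x + z + y
        rearrange = solve-∀

      to : ∀ {n} → (U k n × μ + M ≤ n × [ n + M ] ≤ℕ∞ [ ρ ]) → ∃[ i ] ([ i ] ≤ℕ∞ [ l ] × n ≡ μ + M + i * d)
      to {n} (u , μ+M≤n , AddSup.[ n+M≤ρ ]) = i , AddSup.[ i≤l ] , proj₂ n≡
        where
        n≡ = multiple uμM u μ+M≤n
        i = proj₁ n≡
        i≤l : i ≤ l
        i≤l = *-cancelʳ-≤ i l d (+-cancelˡ-≤ (μ + M) _ _ (+-cancelʳ-≤ M _ _ (begin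
          μ + M + i * d + M   ≡⟨ cong (_+ M) (proj₂ n≡) ⟨
          n + M               ≤⟨ n+M≤ρ ⟩
          ρ                   ≡⟨ ρ≡ ⟩
          μ + M + l * d + M   ∎)))

      from : ∀ {n} → ∃[ i ] ([ i ] ≤ℕ∞ [ l ] × n ≡ μ + M + i * d) → (U k n × μ + M ≤ n × [ n + M ] ≤ℕ∞ [ ρ ])
      from {n} (i , AddSup.[ i≤l ] , n≡) = u , μ+M≤n , AddSup.[ n+M≤ρ ]
        where
        μ+M≤n : μ + M ≤ n
        μ+M≤n = ≤-trans (m≤m+n (μ + M) (i * d)) (≤-reflexive (≡.sym n≡))
        n+M≤ρ : n + M ≤ ρ
        n+M≤ρ = begin
          n + M                 ≡⟨ cong (_+ M) n≡ ⟩
          μ + M + i * d + M     ≤⟨ +-monoˡ-≤ M (+-monoʳ-≤ (μ + M) (*-monoˡ-≤ d i≤l)) ⟩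
          μ + M + l * d + M     ≡⟨ ρ≡ ⟨
          ρ                     ∎
        k≡ : ∃[ t ] k ≡ μ + M + t * d
        k≡ = multiple uμM (U-refl k) μ+M≤k
        t = proj₁ k≡
        difference : ∀ {n n′} i i′ → n ≡ μ + M + i * d → n′ ≡ μ + M + i′ * d → d ∣ n′ ∸ n
        difference i i′ ≡.refl ≡.refl =
          divides (i′ ∸ i) (≡.trans ([m+n]∸[m+o]≡n∸o (μ + M) (i′ * d) (i * d)) (≡.sym (*-distribʳ-∸ d i′ i)))
        u : U k n
        u = Sum.[ (λ k≤n → fill-upper uρ k≤n (difference t i (proj₂ k≡) n≡) n+M≤ρ)
                , (λ n≤k → fill-lower uμ n≤k (difference i t n≡ (proj₂ k≡)) μ+M≤n)
                ]′ (≤-total k n)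

    isAAP : ∀ k → k ≥ 2 * M * m + M → IsAAP d M (U k)
    isAAP k k≥ =
      let μ , min@(uμ , lb) = min-exists em (U-refl k)
          ρ , max@(uρ , ub) = ρ-exists k
          open Interval k k≥ μ ρ uμ lb uρ ub
      in μ , [ ρ ] , min , IsMax⇒IsSup max , congruent , μ + M , [ l ] , to , from

  isAAP-eventually : ∃₂ λ d M → 1 ≤ d × (∃[ k₀ ] (∀ k → k ≥ k₀ → IsAAP d M (U k)))
  isAAP-eventually with e ≟ 0
  -- For `e = 0`, `bound` and symmetry force `U k` to contain only `k`.
  ... | yes ≡.refl = 1 , 0 , ≤-refl , 0 , λ k _ → singleton k
    where
    unique : ∀ {k n} → U k n → n ≡ k
    unique u = ≤-antisym (half u) (half (U-sym u))
      where
      half : ∀ {k n} → U k n → n ≤ k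
      half {k} {n} u = *-cancelʳ-≤ n k m (subst (n * m ≤_) (≡.trans (cong (_* k) (+-identityʳ m)) (*-comm m k)) (bound u))
    singleton : ∀ k → IsAAP 1 0 (U k)
    singleton k =
      k , [ k ] , (U-refl k , λ n u → ≤-reflexive (≡.sym (unique u))) ,
      IsMax⇒IsSup (U-refl k , λ n u → ≤-reflexive (unique u)) ,
      (λ n u → ℤ.+ 0 , ≡.trans (cong ℤ.+_ (unique u)) (≡.sym (ℤ.+-identityʳ (ℤ.+ k)))) ,
      k , [ 0 ] ,
      (λ { (u , _) → 0 , AddSup.[ z≤n ] , ≡.trans (unique u) (≡.sym (+-identityʳ k)) }) ,
      λ { (_ , AddSup.[ z≤n ] , n≡) → let k≡ = ≡.sym (≡.trans n≡ (+-identityʳ k)) in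
          subst (U k) k≡ (U-refl k) ,
          ≤-reflexive (≡.trans (+-identityʳ k) k≡) ,
          AddSup.[ ≤-reflexive (≡.trans (+-identityʳ _) (≡.sym k≡)) ] }
  ... | no e≢0 with min-exists {P = λ t → Difference t × 1 ≤ t} em (e-difference , n≢0⇒n>0 e≢0)
  ... | d , ((k* , u*) , 1≤d) , least = d , M , 1≤d , 2 * M * m + M , P.isAAP
    where
    instance
      d≢0 : NonZero d
      d≢0 = >-nonZero 1≤d

    -- The remainder of a difference modulo `d` is again a difference and smaller than `d`, so
    -- minimality makes it zero.
    d∣differences : ∀ {t} → Difference t → d ∣ t
    d∣differences {t} δ with t % d ≟ 0
    ... | yes r≡0 = m%n≡0⇒n∣m t d r≡0
    ... | no  r≢0 = contradiction (least (t % d) (remainder , n≢0⇒n>0 r≢0)) (<⇒≱ (m%n<n t d))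
      where
      remainder : Difference (t % d)
      remainder = Difference-∸ (subst Difference (m≡m%n+[m/n]*n t d) δ) (Difference-* (t / d) (k* , u*))

    d∣e : d ∣ e
    d∣e = d∣differences e-difference

    f = _∣_.quotient d∣e
    M = e * (c₀ + f * k*)
    M≡ : M ≡ f * (c₀ + f * k*) * d
    M≡ = ≡.trans (cong (_* (c₀ + f * k*)) (_∣_.equality d∣e)) (rearrange f d (c₀ + f * k*))
      where
      rearrange : ∀ f d x → f * d * x ≡ f * x * d
      rearrange = solve-∀
    module P = Progression d k* u* d∣differences f (_∣_.equality d∣e)
      {{≢-nonZero λ f≡0 → e≢0 (≡.trans (_∣_.equality d∣e) (cong (_* d) f≡0))}}
      (f * (c₀ + f * k*)) M M≡ ≤-refl

-- Pairs of largest ratio.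

max-ratio : (V : ℕ → ℕ → Set p) → V 1 1 → (∀ {l} → V 0 l → l ≡ 0) →
  ∀ xs → All (uncurry V) xs →
  ∃₂ λ m s → 1 ≤ m × V m s × All (λ (x , y) → y * m ≤ s * x) xs
max-ratio V v₁ v₀ [] [] = 1 , 1 , ≤-refl , v₁ , []
max-ratio V v₁ v₀ ((x , y) ∷ xs) (v ∷ vs) with max-ratio V v₁ v₀ xs vs
... | m , s , 1≤m , vms , below with y * m ≤? s * x
...   | yes ym≤sx = m , s , 1≤m , vms , ym≤sx ∷ below
...   | no  ym≰sx = x , y , n≢0⇒n>0 x≢0 , v , ≤-refl ∷ All.map (λ {(x′ , y′)} → improve x′ y′) below
  where
  -- For `x ≡ 0` also `y ≡ 0`, and then the old ratio would not be exceeded; so `x` may serve as the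
  -- new denominator.
  x≢0 : x ≢ 0
  x≢0 ≡.refl = ym≰sx (subst (λ z → z * m ≤ s * 0) (≡.sym (v₀ v)) z≤n)
  improve : ∀ x′ y′ → y′ * m ≤ s * x′ → y′ * x ≤ y * x′
  improve x′ y′ below = *-cancelʳ-≤ _ _ m {{>-nonZero 1≤m}} (begin
    y′ * x * m     ≡⟨ swap y′ x m ⟩
    y′ * m * x     ≤⟨ *-monoˡ-≤ x below ⟩
    s * x′ * x     ≡⟨ swap s x′ x ⟩
    s * x * x′     ≤⟨ *-monoˡ-≤ x′ (<⇒≤ (≰⇒> ym≰sx)) ⟩
    y * m * x′     ≡⟨ swap y m x′ ⟩
    y * x′ * m     ∎)
    where
    open ≤-Reasoning
    swap : ∀ a b c → a * b * c ≡ a * c * b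
    swap = solve-∀

-- Dickson's lemma for finitely generated commutative monoids.

module FiniteSpan {c ℓ} (K : CommutativeMonoid c ℓ) where
  open CommutativeMonoid K
  open CommutativeSemigroupProperties commutativeSemigroup using (interchange)
  open Mult monoid using (×-homo-+) renaming (_×_ to _·_)
  open Membership setoid using () renaming (_∈_ to _∈ₛ_)
  open SetoidReasoning setoid

  -- One exponent per generator, in the order of the list, so that induction on the list treats one
  -- coordinate at a time. The exponents need not be unique.
  data Span : List Carrier → Pred Carrier (c ⊔ ℓ) where
    nil  : ∀ {x} → x ≈ ε → Span [] x
    cons : ∀ {g gs x y} k → Span gs y → x ≈ k · g ∙ y → Span (g ∷ gs) x

  Span-resp : ∀ {gs} → Span gs Respects _≈_
  Span-resp x≈y (nil x≈ε)         = nil (trans (sym x≈y) x≈ε)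
  Span-resp x≈y (cons k span x≈)  = cons k span (trans (sym x≈y) x≈)

  Span-ε : ∀ gs → Span gs ε
  Span-ε []       = nil refl
  Span-ε (g ∷ gs) = cons 0 (Span-ε gs) (sym (identityˡ ε))

  Span-∙ : ∀ {gs x y} → Span gs x → Span gs y → Span gs (x ∙ y)
  Span-∙ (nil x≈ε) (nil y≈ε) = nil (trans (∙-cong x≈ε y≈ε) (identityˡ ε))
  Span-∙ {g ∷ gs} {x} {y} (cons {y = x′} j X x≈) (cons {y = y′} k Y y≈) = cons (j + k) (Span-∙ X Y) (begin
    x ∙ y                           ≈⟨ ∙-cong x≈ y≈ ⟩
    (j · g ∙ x′) ∙ (k · g ∙ y′)     ≈⟨ interchange _ _ _ _ ⟩
    (j · g ∙ k · g) ∙ (x′ ∙ y′)     ≈⟨ ∙-congʳ (×-homo-+ g j k) ⟨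
    (j + k) · g ∙ (x′ ∙ y′)         ∎)

  Span-generator : ∀ {gs x} → x ∈ₛ gs → Span gs x
  Span-generator {g ∷ gs} (here x≈g)   = cons 1 (Span-ε gs) (trans x≈g (sym (trans (identityʳ _) (identityʳ g))))
  Span-generator {g ∷ gs} (there x∈gs) = cons 0 (Span-generator x∈gs) (sym (identityˡ _))

  Span-elim : ∀ {q} {Q : Pred Carrier q} → Q Respects _≈_ → Q ε → (∀ {x y} → Q x → Q y → Q (x ∙ y)) →
    ∀ {gs} → All Q gs → ∀ {x} → Span gs x → Q x
  Span-elim resp qε q∙ [] (nil x≈ε) = resp (sym x≈ε) qε
  Span-elim {Q = Q} resp qε q∙ {g ∷ _} (qg ∷ qgs) (cons k span x≈) =
    resp (sym x≈) (q∙ (power k) (Span-elim resp qε q∙ qgs span))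
    where
    power : ∀ k → Q (k · g)
    power zero    = qε
    power (suc k) = q∙ qg (power k)

  -- The cofactor `u` has to lie in the span so that a descent can go on with it.
  DivisibleBy : List Carrier → Carrier → Pred Carrier (c ⊔ ℓ)
  DivisibleBy gs x b = ∃[ u ] (Span gs u × x ≈ b ∙ u)

  -- Dickson's lemma: it suffices to treat the elements with a large exponent of g at once, and the
  -- finitely many small exponents one by one.
  finite-basis : ExcludedMiddle (c ⊔ ℓ) → ∀ gs (P : Pred Carrier (c ⊔ ℓ)) → P Respects _≈_ →
    ∃[ bs ] (All P bs × All (Span gs) bs × (∀ {x} → Span gs x → P x → Any (DivisibleBy gs x) bs))
  finite-basis em [] P resp with em {P ε}
  ... | yes pε = ε ∷ [] , pε ∷ [] , nil refl ∷ [] , λ { (nil x≈ε) _ → here (ε , nil refl , trans x≈ε (sym (identityˡ ε))) }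
  ... | no ¬pε = [] , [] , [] , λ { (nil x≈ε) px → contradiction (resp x≈ε px) ¬pε }
  finite-basis em (g ∷ gs) P resp
    -- This is the projection of `P` that forgets the exponent of `g`.
    with finite-basis em gs (λ y → ∃[ k ] P (k · g ∙ y)) (λ x≈y (k , px) → k , resp (∙-congˡ x≈y) px)
  ... | ys , pys , Ys , cover with tops ys pys Ys
    where
    -- Each basis element `y` of the projection comes with an exponent `j` for which `j · g ∙ y`
    -- satisfies `P`. From the maximum `K` of these exponents on, divisibility by `y` lifts to
    -- divisibility by `j · g ∙ y`.
    tops : ∀ ys → All (λ y → ∃[ k ] P (k · g ∙ y)) ys → All (Span gs) ys →
      ∃₂ λ K bs → All P bs × All (Span (g ∷ gs)) bs ×
        (∀ k → K ≤ k → ∀ {x z} → x ≈ k · g ∙ z → Any (DivisibleBy gs z) ys → Any (DivisibleBy (g ∷ gs) x) bs)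
    tops [] [] [] = 0 , [] , [] , [] , λ _ _ _ ()
    tops (y ∷ ys) ((j , py) ∷ pys) (Y ∷ Ys) with tops ys pys Ys
    ... | K , bs , pbs , Bs , cover =
      j ℕ⊔ K , j · g ∙ y ∷ bs , py ∷ pbs , cons j Y refl ∷ Bs , cover′
      where
      cover′ : ∀ k → j ℕ⊔ K ≤ k → ∀ {x z} → x ≈ k · g ∙ z → Any (DivisibleBy gs z) (y ∷ ys) →
        Any (DivisibleBy (g ∷ gs) x) (j · g ∙ y ∷ bs)
      cover′ k j⊔K≤k x≈ (there any) = there (cover k (m⊔n≤o⇒n≤o j K j⊔K≤k) x≈ any)
      cover′ k j⊔K≤k {x} {z} x≈ (here (u , U , z≈)) = here ((k ∸ j) · g ∙ u , cons (k ∸ j) U refl , (begin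
        x                                   ≈⟨ x≈ ⟩
        k · g ∙ z                           ≈⟨ ∙-congˡ z≈ ⟩
        k · g ∙ (y ∙ u)                     ≡⟨ cong (λ i → i · g ∙ (y ∙ u)) (m+[n∸m]≡n (m⊔n≤o⇒m≤o j K j⊔K≤k)) ⟨
        (j + (k ∸ j)) · g ∙ (y ∙ u)         ≈⟨ ∙-congʳ (×-homo-+ g j (k ∸ j)) ⟩
        (j · g ∙ (k ∸ j) · g) ∙ (y ∙ u)     ≈⟨ interchange _ _ _ _ ⟩
        (j · g ∙ y) ∙ ((k ∸ j) · g ∙ u)     ∎))
  ...   | K , bs , pbs , Bs , high with slices K
    where
    slices : ∀ K → ∃[ bs ] (All P bs × All (Span (g ∷ gs)) bs ×
      (∀ k → k < K → ∀ {x z} → x ≈ k · g ∙ z → Span gs z → P x → Any (DivisibleBy (g ∷ gs) x) bs))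
    slices zero = [] , [] , [] , λ _ ()
    slices (suc K) with slices K | finite-basis em gs (λ y → P (K · g ∙ y)) (λ x≈y → resp (∙-congˡ x≈y))
    ... | bs , pbs , Bs , low | ys , pys , Ys , cover =
      map (K · g ∙_) ys ++ bs , All.++⁺ (All.map⁺ pys) pbs ,
      All.++⁺ (All.map⁺ (All.map (λ Y → cons K Y refl) Ys)) Bs , cover′
      where
      cover′ : ∀ k → k < suc K → ∀ {x z} → x ≈ k · g ∙ z → Span gs z → P x →
        Any (DivisibleBy (g ∷ gs) x) (map (K · g ∙_) ys ++ bs)
      cover′ k k<1+K x≈ Z px with m≤n⇒m<n∨m≡n (≤-pred k<1+K)
      ... | inj₁ k<K    = Any.++⁺ʳ _ (low k k<K x≈ Z px)
      ... | inj₂ ≡.refl = Any.++⁺ˡ (Any.map⁺ (Any.map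
        (λ (u , U , z≈) → u , cons 0 U (sym (identityˡ u)) , trans x≈ (trans (∙-congˡ z≈) (sym (assoc _ _ u))))
        (cover Z (resp x≈ px))))
  ...     | bs′ , pbs′ , Bs′ , low = bs ++ bs′ , All.++⁺ pbs pbs′ , All.++⁺ Bs Bs′ , cover′
    where
    cover′ : ∀ {x} → Span (g ∷ gs) x → P x → Any (DivisibleBy (g ∷ gs) x) (bs ++ bs′)
    cover′ (cons k Y x≈) px with <-≤-connex k K
    ... | inj₁ k<K = Any.++⁺ʳ bs (low k k<K x≈ Y px)
    ... | inj₂ K≤k = Any.++⁺ˡ (high k K≤k x≈ (cover Y (k , resp x≈ px)))

-- The fractions are normalised; passing to unnormalised rationals turns the order into cross
-- multiplication.
/-≤⇒*-≤ : ∀ a m b n .{{_ : NonZero m}} .{{_ : NonZero n}} → ℤ.+ a ℚ./ m ℚ.≤ ℤ.+ b ℚ./ n → a * n ≤ b * m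
/-≤⇒*-≤ a m@(suc m-1) b n@(suc n-1) a/m≤b/n = ℤ.drop‿+≤+ (subst₂ ℤ._≤_ (≡.sym (ℤ.pos-* a n)) (≡.sym (ℤ.pos-* b m))
  (ℚᵘ.drop-*≤* (ℚᵘ.≤-respˡ-≃ (ℚ.toℚᵘ-fromℚᵘ (ℚᵘ.mkℚᵘ (ℤ.+ a) m-1))
    (ℚᵘ.≤-respʳ-≃ (ℚ.toℚᵘ-fromℚᵘ (ℚᵘ.mkℚᵘ (ℤ.+ b) n-1)) (ℚ.toℚᵘ-mono-≤ a/m≤b/n)))))

-- It follows that ρ_k = (s / m) k + O(1).
record AsymptoticElasticity {p} (U : ℕ → Pred ℕ p) : Set p where
  field
    m s c₀   : ℕ
    1≤m      : 1 ≤ m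
    attained : ∀ j → U (j * m + c₀) (j * s + c₀)
    bound    : ∀ {k l} → U k l → l * m ≤ s * k

-- Lengths in a reduced atomic unit-cancellative monoid.

module AtomicMonoid {c ℓ} (em : ExcludedMiddle (c ⊔ ℓ)) (H : Monoid c ℓ)
  (nontrivial : ¬ Factorization.IsTrivial H) (reduced : Factorization.IsReduced H)
  (atomic : Factorization.IsAtomic H) (unitCancellative : Factorization.IsUnitCancellative H)
  where

  open Factorization H
  open Monoid H

  -- From `a ∙ b ≈ ε` follows `a ≈ a ∙ (b ∙ a)`, so `b ∙ a` is a unit by unit-cancellativity and
  -- trivial by reducedness.
  invertible-left : ∀ {a b} → a ∙ b ≈ ε → IsUnit a
  invertible-left {a} {b} ab≈ε = b , ba≈ε , ab≈ε
    where
    ba≈ε : b ∙ a ≈ ε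
    ba≈ε = reduced _ (unitCancellative a (b ∙ a)
      (inj₁ (sym (trans (sym (assoc a b a)) (trans (∙-congʳ ab≈ε) (identityˡ a))))))

  π≈ε⇒length≡0 : ∀ z → π z ≈ ε → length z ≡ 0
  π≈ε⇒length≡0 []            _    = ≡.refl
  π≈ε⇒length≡0 ((u , atom) ∷ z) πz≈ε = contradiction (invertible-left πz≈ε) (proj₁ atom)

  L-ε : L ε 0
  L-ε = [] , ≡.refl , refl

  L-resp : ∀ {a b k} → a ≈ b → L a k → L b k
  L-resp a≈b (z , len , πz) = z , len , trans πz a≈b

  L-∙ : ∀ {a b k l} → L a k → L b l → L (a ∙ b) (k + l)
  L-∙ (z , ≡.refl , πz) (w , ≡.refl , πw) = z ++ w , length-++ z , trans (π-++ z w) (∙-cong πz πw)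

  L-atom : (u : Atom) → L (proj₁ u) 1
  L-atom u = u ∷ [] , ≡.refl , identityʳ _

  L-nonempty : ∀ a → ∃ (L a)
  L-nonempty a with em {IsUnit a}
  ... | yes unit    = 0 , [] , ≡.refl , sym (reduced a unit)
  ... | no  nonunit = let z , πz≈a = atomic a nonunit in length z , z , ≡.refl , πz≈a

  0∈L⇒≈ε : ∀ {a} → L a 0 → a ≈ ε
  0∈L⇒≈ε ([] , _ , ε≈a) = sym ε≈a

  L[ε] : ∀ {a k} → a ≈ ε → L a k → k ≡ 0
  L[ε] a≈ε (z , ≡.refl , πz≈a) = π≈ε⇒length≡0 z (trans πz≈a a≈ε)

  atom-exists : Atom
  atom-exists with em {∃[ a ] ¬ IsUnit a}
  ... | no none = contradiction trivial′ nontrivial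
    where
    trivial′ : IsTrivial
    trivial′ a with em {IsUnit a}
    ... | yes unit = reduced a unit
    ... | no nonunit = contradiction (a , nonunit) none
  ... | yes (a , nonunit) with atomic a nonunit
  ...   | [] , ε≈a    = contradiction (ε , trans (identityˡ a) (sym ε≈a) , trans (identityʳ a) (sym ε≈a)) nonunit
  ...   | (u ∷ _) , _ = u

  U-0 : ∀ {l} → U 0 l → l ≡ 0
  U-0 (a , 0∈L , l∈L) = L[ε] (0∈L⇒≈ε 0∈L) l∈L

  U-isLengthRelation : IsLengthRelation U
  U-isLengthRelation = record
    { U-refl = λ k → let z = replicate k atom-exists ; len = length-replicate k in
                     π z , (z , len , refl) , (z , len , refl)
    ; U-sym  = λ (a , k∈L , l∈L) → a , l∈L , k∈L
    ; U-add  = λ (a , k∈L , l∈L) (b , k′∈L , l′∈L) → a ∙ b , L-∙ k∈L k′∈L , L-∙ l∈L l′∈L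
    }

  open IsLengthRelation U-isLengthRelation

  conclusion : AsymptoticElasticity U → BoundedRhoDifferences × StructureTheoremForUnions
  conclusion A = Un.bounded-rho-differences , Un.isAAP-eventually
    where
    open AsymptoticElasticity A
    -- The diagonal pair `(1 , 1)` obeys `bound`, so `s ∸ m` is a genuine difference.
    m≤s : m ≤ s
    m≤s = subst₂ _≤_ (*-identityˡ m) (*-identityʳ s) (bound (U-refl 1))
    s≡m+e = ≡.sym (m+[n∸m]≡n m≤s)
    attained′ : ∀ j → U (j * m + c₀) (j * (m + (s ∸ m)) + c₀)
    attained′ j = subst (λ x → U (j * m + c₀) (j * x + c₀)) s≡m+e (attained j)
    bound′ : ∀ {k l} → U k l → l * m ≤ (m + (s ∸ m)) * k
    bound′ {k} {l} u = subst (λ x → l * m ≤ x * k) s≡m+e (bound u)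
    module Un = Unions em U U-isLengthRelation m (s ∸ m) c₀ {{>-nonZero 1≤m}} attained′ bound′

  attained-bound : ∀ {m s} → 1 ≤ m → U m s → (∀ {k l} → U k l → l * m ≤ s * k) → AsymptoticElasticity U
  attained-bound {m} {s} 1≤m u bound = record
    { m = m ; s = s ; c₀ = 0 ; 1≤m = 1≤m ; bound = bound
    ; attained = λ j → subst₂ U (≡.sym (+-identityʳ _)) (≡.sym (+-identityʳ _)) (U-mult j u)
    }

  -- Case (a): accepted elasticity.

  elasticity-attained : ∀ {a r q} → IsElasticity (L a) r → r ≡ [ q ] →
    ∃₂ λ m s → ∃[ nz ] (U m s × ℚ._/_ (ℤ.+ s) m {{nz}} ≡ q)
  -- Without positive lengths the elasticity is 1 by convention, and `(1 , 1)` realises it.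
  elasticity-attained (trivial _) ≡.refl = 1 , 1 , _ , U-refl 1 , ≡.refl
  -- A finite supremum is a maximum, so `m` and `s` are both lengths of `a`.
  elasticity-attained {a} (ratio {m} {[ s ]} ((m∈L , 1≤m) , _) sup) eq =
    m , s , >-nonZero 1≤m , (a , m∈L , proj₁ (proj₁ (IsSup⇒IsMax em (m∈L , 1≤m) sup))) , []-injective eq
  elasticity-attained (ratio {s = ⊤⁺} _ _) ()

  accepted-elasticity : HasAcceptedElasticity → AsymptoticElasticity U
  accepted-elasticity (a , q , elast , ub , _) with elasticity-attained elast ≡.refl
  ... | m , s , nz , u , ≡.refl = attained-bound (>-nonZero⁻¹ m {{nz}}) u bound
    where
    bound : ∀ {k l} → U k l → l * m ≤ s * k
    bound {zero}  {l} v = subst (λ x → x * m ≤ s * 0) (≡.sym (U-0 v)) z≤n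
    bound {suc k} {zero} v = z≤n
    -- For positive lengths the ratio is at most the elasticity of `L b`, hence at most `s / m`.
    bound {suc k} {suc l} (b , k∈L , l∈L)
      with min-exists {P = L b ∩ Positive} em (k∈L , s≤s z≤n) | sup-exists {P = L b ∩ Positive} em (k∈L , s≤s z≤n)
    ... | m′ , min@((_ , 1≤m′) , lb) | [ s′ ] , sup = begin
      suc l * m     ≤⟨ *-monoˡ-≤ m ([≤]-injective (proj₁ sup _ (suc l , (l∈L , s≤s z≤n) , ≡.refl))) ⟩
      s′ * m        ≤⟨ /-≤⇒*-≤ s′ m′ s m {{>-nonZero 1≤m′}} {{nz}} (AddSup.[≤]-injective ℚ._≤_
                         (ub _ (b , ratio {{>-nonZero 1≤m′}} min sup))) ⟩
      s * m′        ≤⟨ *-monoʳ-≤ s (lb (suc k) (k∈L , s≤s z≤n)) ⟩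
      s * suc k     ∎
      where open ≤-Reasoning
    ... | m′ , min@((_ , 1≤m′) , lb) | ⊤⁺ , sup with ub _ (b , ratio {{>-nonZero 1≤m′}} min sup)
    ...   | ()

  -- Case (b): finitely generated monoid of relations.

  ≈ᶻ⇒length≡ : ∀ {x y} → x ≈ᶻ y → length x ≡ length y
  ≈ᶻ⇒length≡ (inj₁ x≋y)       = Pointwise-length x≋y
  ≈ᶻ⇒length≡ (inj₂ (_ , x↭y)) = Permutation.xs↭ys⇒|xs|≡|ys| atoms x↭y

  lengths : Relation → ℕ × ℕ
  lengths ((x , y) , _) = length x , length y

  -- Lengths are additive on the monoid of relations, so the linear inequality `l * m ≤ s * k`
  -- passes from generators to products. The generators give length pairs, hence `(m , s)` is one.
  finitely-generated-relations : FinitelyGenerated relationMonoid → AsymptoticElasticity U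
  finitely-generated-relations (gs , generates)
    with max-ratio U (U-refl 1) U-0 (map lengths gs)
           (All.map⁺ (All.universal (λ ((x , y) , x∼y) → π y , (x , ≡.refl , x∼y) , (y , ≡.refl , refl)) gs))
  ... | m , s , 1≤m , u , below = attained-bound 1≤m u bound
    where
    module R = Monoid relationMonoid
    Below : Pred Relation _
    Below ((x , y) , _) = length y * m ≤ s * length x

    Below-resp : ∀ {r t} → r R.≈ t → Below r → Below t
    Below-resp {(x , y) , _} {(x′ , y′) , _} (x≈ , y≈) =
      subst₂ (λ k l → l * m ≤ s * k) (≈ᶻ⇒length≡ x≈) (≈ᶻ⇒length≡ y≈)

    Below-generator : ∀ {r} → Membership._∈_ R.setoid r gs → Below r
    Below-generator {r} r∈gs =
      All.lookupₛ R.setoid {P = Below} (λ {r} {t} → Below-resp {r} {t}) (All.map⁻ below) {x = r} r∈gs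

    Below-product : ∀ rs → All (λ r → Membership._∈_ R.setoid r gs) rs → Below (foldr R._∙_ R.ε rs)
    Below-product [] [] = z≤n
    Below-product (r@((x , y) , _) ∷ rs) (r∈gs ∷ rs∈gs) with foldr R._∙_ R.ε rs | Below-product rs rs∈gs
    ... | ((x′ , y′) , _) | below′ = begin
      length (y ++ y′) * m              ≡⟨ cong (_* m) (length-++ y) ⟩
      (length y + length y′) * m        ≡⟨ *-distribʳ-+ m (length y) (length y′) ⟩
      length y * m + length y′ * m      ≤⟨ +-mono-≤ (Below-generator {r} r∈gs) below′ ⟩
      s * length x + s * length x′      ≡⟨ *-distribˡ-+ s (length x) (length x′) ⟨
      s * (length x + length x′)        ≡⟨ cong (s *_) (length-++ x) ⟨
      s * length (x ++ x′)              ∎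
      where open ≤-Reasoning

    bound : ∀ {k l} → U k l → l * m ≤ s * k
    bound (a , (x , ≡.refl , πx) , (y , ≡.refl , πy)) =
      let x∼y = trans πx (sym πy)
          rs , rs∈gs , rs≈ = generates ((x , y) , x∼y)
      in Below-resp {foldr R._∙_ R.ε rs} {(x , y) , x∼y} rs≈ (Below-product rs rs∈gs)

  -- Case (c): finitely generated commutative monoids.

  module _ (comm : IsCommutative) where

    H-comm : CommutativeMonoid c ℓ
    H-comm = record { isCommutativeMonoid = record { isMonoid = isMonoid ; comm = comm } }

    open CommutativeSemigroupProperties (CommutativeMonoid.commutativeSemigroup H-comm)
      using (xy∙z≈xz∙y)

    -- This is equality of images in the quotient group, the least cancellative congruence on `H`.
    StablyEqual : Carrier → Carrier → Set (c ⊔ ℓ)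
    StablyEqual a b = ∃[ z ] (a ∙ z ≈ b ∙ z)

    StablyEqual-resp : ∀ {a b a′ b′} → a ≈ a′ → b ≈ b′ → StablyEqual a b → StablyEqual a′ b′
    StablyEqual-resp a≈ b≈ (z , az≈bz) = z , trans (∙-congʳ (sym a≈)) (trans az≈bz (∙-congʳ b≈))

    -- If `a z = b z` and `a a′ w = b b′ w`, then `b z w` serves as common factor, since it equals
    -- `a z w`.
    StablyEqual-cancel : ∀ {a b a′ b′} → StablyEqual a b → StablyEqual (a ∙ a′) (b ∙ b′) → StablyEqual a′ b′
    StablyEqual-cancel {a} {b} {a′} {b′} (z , az≈bz) (w , eq) = b ∙ z ∙ w , (begin
      a′ ∙ (b ∙ z ∙ w)      ≈⟨ ∙-congˡ (∙-congʳ az≈bz) ⟨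
      a′ ∙ (a ∙ z ∙ w)      ≈⟨ shuffle a a′ ⟨
      a ∙ a′ ∙ w ∙ z        ≈⟨ ∙-congʳ eq ⟩
      b ∙ b′ ∙ w ∙ z        ≈⟨ shuffle b b′ ⟩
      b′ ∙ (b ∙ z ∙ w)      ∎)
      where
      open SetoidReasoning setoid
      shuffle : ∀ a a′ → a ∙ a′ ∙ w ∙ z ≈ a′ ∙ (a ∙ z ∙ w)
      shuffle a a′ = begin
        a ∙ a′ ∙ w ∙ z       ≈⟨ assoc (a ∙ a′) w z ⟩
        a ∙ a′ ∙ (w ∙ z)     ≈⟨ ∙-congʳ (comm a a′) ⟩
        a′ ∙ a ∙ (w ∙ z)     ≈⟨ assoc a′ a (w ∙ z) ⟩
        a′ ∙ (a ∙ (w ∙ z))   ≈⟨ ∙-congˡ (∙-congˡ (comm w z)) ⟩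
        a′ ∙ (a ∙ (z ∙ w))   ≈⟨ ∙-congˡ (assoc a z w) ⟨
        a′ ∙ (a ∙ z ∙ w)     ∎

    open Mult H using () renaming (_×_ to _·_)

    -- The same `z` serves for all powers, which makes `c₀` independent of `j`.
    StablyEqual-power : ∀ {a b z} → a ∙ z ≈ b ∙ z → ∀ j → j · a ∙ z ≈ j · b ∙ z
    StablyEqual-power az≈bz zero = refl
    StablyEqual-power {a} {b} {z} az≈bz (suc j) = begin
      a ∙ j · a ∙ z      ≈⟨ assoc a (j · a) z ⟩
      a ∙ (j · a ∙ z)    ≈⟨ ∙-congˡ (StablyEqual-power az≈bz j) ⟩
      a ∙ (j · b ∙ z)    ≈⟨ ∙-congˡ (comm (j · b) z) ⟩
      a ∙ (z ∙ j · b)    ≈⟨ assoc a z (j · b) ⟨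
      a ∙ z ∙ j · b      ≈⟨ ∙-congʳ az≈bz ⟩
      b ∙ z ∙ j · b      ≈⟨ xy∙z≈xz∙y b z (j · b) ⟩
      b ∙ j · b ∙ z      ∎
      where open SetoidReasoning setoid

    L-power : ∀ {a k} → L a k → ∀ j → L (j · a) (j * k)
    L-power k∈L zero    = L-ε
    L-power k∈L (suc j) = L-∙ k∈L (L-power k∈L j)

    StableLengths : ℕ → ℕ → Set (c ⊔ ℓ)
    StableLengths k l = ∃₂ λ a b → L a k × L b l × StablyEqual a b

    -- With `a ≈ ε`, stable equality reads `z ≈ b ∙ z`, so `b` is a unit by unit-cancellativity.
    StableLengths-0 : ∀ {l} → StableLengths 0 l → l ≡ 0
    StableLengths-0 (a , b , 0∈L , l∈L , z , az≈bz) = L[ε] (reduced b (unitCancellative z b (inj₂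
      (trans (sym (identityˡ z)) (trans (∙-congʳ (sym (0∈L⇒≈ε 0∈L))) az≈bz))))) l∈L

    StableLengths⇒attained : ∀ {m s} → StableLengths m s → ∃[ c₀ ] (∀ j → U (j * m + c₀) (j * s + c₀))
    StableLengths⇒attained (a , b , m∈L , s∈L , z , az≈bz) with L-nonempty z
    ... | c₀ , c₀∈L = c₀ , λ j → j · b ∙ z ,
      L-resp (StablyEqual-power az≈bz j) (L-∙ (L-power m∈L j) c₀∈L) , L-∙ (L-power s∈L j) c₀∈L

    -- (a , k) ∈ T stands for an element a together with a factorization length k of a.
    T = DirectProduct.commutativeMonoid H-comm +-0-commutativeMonoid
    K = DirectProduct.commutativeMonoid T T
    module K = CommutativeMonoid K
    open FiniteSpan K

    module _ (as : List Atom) (enumerates : ∀ u → Membership._∈_ atoms u as) where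

      left right : Atom → K.Carrier
      left  (u , _) = (u , 1) , (ε , 0)
      right (u , _) = (ε , 0) , (u , 1)

      generators : List K.Carrier
      generators = map left as ++ map right as

      Factorizations : Pred K.Carrier (c ⊔ ℓ)
      Factorizations ((a , k) , (b , l)) = L a k × L b l

      Span⇒L : ∀ {x} → Span generators x → Factorizations x
      Span⇒L = Span-elim {Q = Factorizations}
        (λ { ((a≈ , ≡.refl) , (b≈ , ≡.refl)) (k∈L , l∈L) → L-resp a≈ k∈L , L-resp b≈ l∈L })
        (L-ε , L-ε)
        (λ (k∈L , l∈L) (k′∈L , l′∈L) → L-∙ k∈L k′∈L , L-∙ l∈L l′∈L)
        (All.++⁺ (All.map⁺ (All.universal (λ u → L-atom u , L-ε) as))
                 (All.map⁺ (All.universal (λ u → L-ε , L-atom u) as)))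

      L⇒Span : ∀ {a b k l} → L a k → L b l → Span generators ((a , k) , (b , l))
      L⇒Span {a} {b} (x , ≡.refl , πx) (y , ≡.refl , πy) =
        Span-resp ((trans (identityʳ _) πx , +-identityʳ _) , (trans (identityˡ _) πy , ≡.refl))
          (Span-∙ (lefts x) (rights y))
        where
        lefts : ∀ x → Span generators ((π x , length x) , (ε , 0))
        lefts []      = Span-ε generators
        lefts (u ∷ x) = Span-resp ((refl , ≡.refl) , (identityˡ ε , ≡.refl)) (Span-∙
          (Span-generator (Any.++⁺ˡ (Any.map⁺ (Any.map (λ u≈ → (u≈ , ≡.refl) , (refl , ≡.refl)) (enumerates u)))))
          (lefts x))
        rights : ∀ y → Span generators ((ε , 0) , (π y , length y))
        rights []      = Span-ε generators
        rights (u ∷ y) = Span-resp ((identityˡ ε , ≡.refl) , (refl , ≡.refl)) (Span-∙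
          (Span-generator (Any.++⁺ʳ (map left as)
            (Any.map⁺ (Any.map (λ u≈ → (refl , ≡.refl) , (u≈ , ≡.refl)) (enumerates u)))))
          (rights y))

      -- Total length zero is excluded so that removing a basis element strictly lowers the total
      -- length.
      NonzeroRelation : Pred K.Carrier (c ⊔ ℓ)
      NonzeroRelation ((a , k) , (b , l)) = 1 ≤ k + l × StablyEqual a b

      NonzeroRelation-resp : NonzeroRelation Respects K._≈_
      NonzeroRelation-resp ((a≈ , ≡.refl) , (b≈ , ≡.refl)) (1≤ , a~b) = 1≤ , StablyEqual-resp a≈ b≈ a~b

      finitely-many-atoms : AsymptoticElasticity U
      finitely-many-atoms with finite-basis em generators NonzeroRelation NonzeroRelation-resp
      ... | bs , Pbs , Bs , cover
        with max-ratio StableLengths (proj₁ u , proj₁ u , L-atom u , L-atom u , ε , refl) StableLengths-0 (map degrees bs)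
               (All.map⁺ (All.zipWith (λ (B , (_ , a~b)) → _ , _ , proj₁ (Span⇒L B) , proj₂ (Span⇒L B) , a~b) (Bs , Pbs)))
        where
        u = atom-exists
        degrees : K.Carrier → ℕ × ℕ
        degrees ((_ , k) , (_ , l)) = k , l
      ...   | m , s , 1≤m , v , below with StableLengths⇒attained v
      ...     | c₀ , attained = record
        { m = m ; s = s ; c₀ = c₀ ; 1≤m = 1≤m ; attained = attained
        ; bound = λ {k} {l} (a , k∈L , l∈L) → descent (k + l) ≤-refl (L⇒Span k∈L l∈L) (ε , refl)
        }
        where
        -- Removing a basis element from an equality in `H` leaves only a stable equality in
        -- general, so the induction on the total length runs over stable equalities.
        descent : ∀ n {a k b l} → k + l ≤ n → Span generators ((a , k) , (b , l)) →
          StablyEqual a b → l * m ≤ s * k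
        descent zero    {k = zero} {l = zero} _ _ _ = z≤n
        descent (suc n) {k = k} {l = l} k+l≤1+n X a~b with k + l ≟ 0
        ... | yes k+l≡0 = subst (λ x → x * m ≤ s * k) (≡.sym (m+n≡0⇒n≡0 k k+l≡0)) z≤n
        ... | no  k+l≢0
          with Any.lookup divisor | All.lookupAny (All.zip (Pbs , All.map⁻ below)) divisor
          where divisor = cover X (n≢0⇒n>0 k+l≢0 , a~b)
        ...   | (a₀ , k₀) , (b₀ , l₀)
              | ((1≤k₀+l₀ , a₀~b₀) , below₀) , ((a′ , k′) , (b′ , l′)) , X′ , (a≈ , ≡.refl) , (b≈ , ≡.refl) = begin
          (l₀ + l′) * m        ≡⟨ *-distribʳ-+ m l₀ l′ ⟩
          l₀ * m + l′ * m      ≤⟨ +-mono-≤ below₀ (descent n smaller X′ a′~b′) ⟩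
          s * k₀ + s * k′      ≡⟨ *-distribˡ-+ s k₀ k′ ⟨
          s * (k₀ + k′)        ∎
          where
          open ≤-Reasoning
          a′~b′ : StablyEqual a′ b′
          a′~b′ = StablyEqual-cancel a₀~b₀ (StablyEqual-resp a≈ b≈ a~b)
          rearrange : ∀ k₀ k′ l₀ l′ → (k₀ + l₀) + (k′ + l′) ≡ (k₀ + k′) + (l₀ + l′)
          rearrange = solve-∀
          smaller : k′ + l′ ≤ n
          smaller = ≤-pred (≤-trans (+-monoˡ-≤ (k′ + l′) 1≤k₀+l₀)
            (≤-trans (≤-reflexive (rearrange k₀ k′ l₀ l′)) k+l≤1+n))

    -- Atoms of a finitely generated commutative monoid.

    finitely-generated : FinitelyGenerated H → AsymptoticElasticity U
    finitely-generated (gs , generates) =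
      let as , enumerates = atoms-among gs in finitely-many-atoms as λ u → enumerates u (atom∈generators u)
      where
      open Membership setoid using () renaming (_∈_ to _∈ₛ_)

      unit-product : ∀ {u x y} → IsUnit x → u ≈ x ∙ y → u ≈ y
      unit-product {y = y} unit u≈xy = trans u≈xy (trans (∙-congʳ (reduced _ unit)) (identityˡ y))

      -- One of head and tail is a unit, hence trivial: either the head is dropped, or the atom
      -- equals the head.
      atom∈product : ∀ {u} → IsAtom u → ∀ xs → All (_∈ₛ gs) xs → u ≈ foldr _∙_ ε xs → u ∈ₛ gs
      atom∈product (nonunit , _) [] [] u≈ε =
        contradiction (ε , trans (identityˡ _) u≈ε , trans (identityʳ _) u≈ε) nonunit
      atom∈product atom@(_ , irreducible) (x ∷ xs) (x∈gs ∷ xs∈gs) u≈ with irreducible _ _ u≈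
      ... | inj₁ unit = atom∈product atom xs xs∈gs (unit-product unit u≈)
      ... | inj₂ unit = Any.map (trans (unit-product unit (trans u≈ (comm _ _)))) x∈gs

      atom∈generators : ((u , _) : Atom) → u ∈ₛ gs
      atom∈generators (u , atom) = let xs , xs∈gs , πxs≈u = generates u in atom∈product atom xs xs∈gs (sym πxs≈u)

      IsAtom-resp : IsAtom Respects _≈_
      IsAtom-resp x≈y (nonunit , irreducible) =
        (λ (z , zy≈ε , yz≈ε) → nonunit (z , trans (∙-congˡ x≈y) zy≈ε , trans (∙-congʳ x≈y) yz≈ε)) ,
        λ a b y≈ab → irreducible a b (trans x≈y y≈ab)

      atoms-among : ∀ gs → ∃[ as ] (∀ (u : Atom) → proj₁ u ∈ₛ gs → Membership._∈_ atoms u as)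
      atoms-among [] = [] , λ _ ()
      atoms-among (g ∷ gs) with atoms-among gs | em {IsAtom g}
      ... | as , enumerates | yes atom = (g , atom) ∷ as , λ
        { u (here u≈g) → here u≈g ; u (there u∈gs) → there (enumerates u u∈gs) }
      ... | as , enumerates | no ¬atom = as , λ
        { (u , atom) (here u≈g) → contradiction (IsAtom-resp u≈g atom) ¬atom
        ; u (there u∈gs) → enumerates u u∈gs
        }

theorem3p6 : ∀ {c ℓ} → ExcludedMiddle (c ⊔ ℓ) → (H : Monoid c ℓ) →
    let open Factorization H in
    ¬ IsTrivial → IsReduced → IsAtomic → IsUnitCancellative →
    (IsFinitelyPresented × HasAcceptedElasticity)
    ⊎ (IsCancellative × FinitelyGenerated relationMonoid)
    ⊎ (IsCommutative × FinitelyGenerated H) →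
    BoundedRhoDifferences × StructureTheoremForUnions
theorem3p6 em H nontrivial reduced atomic unitCancellative = λ
  { (inj₁ (_ , accepted))     → conclusion (accepted-elasticity accepted)
  ; (inj₂ (inj₁ (_ , fg)))    → conclusion (finitely-generated-relations fg)
  ; (inj₂ (inj₂ (comm , fg))) → conclusion (finitely-generated comm fg)
  }
  where open AtomicMonoid em H nontrivial reduced atomic unitCancellative
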